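{- Let $k\ge 1$, $0\le \ell\le k-1$ and $r\ge 0$ be integers. The number $\tilde{\mathcal P}_{r,k,\ell}$ of $k$-paths of length $n=kr+2\ell$ such that (i) each internal $(u,h)$-segment has length equal to a multiple of $k$, and (ii) the first $(u,h)$-segment has length $\equiv \ell \pmod k$, is $$\tilde{\mathcal P}_{r,k,\ell}=\sum_{p=0}^{\lfloor r/2\rfloor}\frac{\ell+1}{kp+\ell+1}\binom{(k+1)p+\ell}{p}\binom{r+2(k-1)p+2\ell}{r-2p}.$$
   Context: For $k\ge1$, a $k$-path of length $n$ is a lattice path from $(0,0)$ to $(n,0)$ with steps $u=(1,1)$, $d=(1,-1)$, $h=(k,0)$ that never goes below the $x$-axis. A $(u,h)$-segment of a $k$-path is a maximal segment of consecutive steps composed of up-steps $u$ and horizontal-steps $h$; its length is its horizontal extent, i.e. each $u$ contributes $1$ and each $h$ contributes $k$. An internal $(u,h)$-segment is a $(u,h)$-segment between two down-steps. The first $(u,h)$-segment is the one with which the path begins (for the empty path it is taken to be empty, of length $0$). -}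

module Defs where

open import Data.Nat.Base as ℕ using (ℕ; suc; NonZero; _∸_; _%_)
open import Data.Nat.Combinatorics using (_C_)
open import Data.Nat.Divisibility using (_∣_)
open import Data.Integer.Base as ℤ using (ℤ; +_; 0ℤ; 1ℤ; -1ℤ)
open import Data.Rational.Base as ℚ using (ℚ; +-0-rawMonoid)
open import Data.Fin.Base using (toℕ)
open import Data.List.Base using (List; []; _∷_; _++_; _∷ʳ_; length)
open import Data.List.Membership.Propositional using (_∈_)
open import Data.List.Relation.Unary.All using (All)
open import Data.List.Relation.Unary.Unique.Propositional using (Unique)
open import Data.Product.Base using (Σ-syntax; ∃-syntax; _×_)
open import Function.Bundles using (_⇔_)
open import Relation.Binary.PropositionalEquality using (_≡_)
open import Algebra.Definitions.RawMonoid +-0-rawMonoid using (sum)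

data Step : Set where
  u d h : Step

-- The displacement of a step s is the vector (run k s , rise s).

run : ℕ → Step → ℕ
run k u = 1
run k d = 1
run k h = k

rise : Step → ℤ
rise u = 1ℤ
rise d = -1ℤ
rise h = 0ℤ

extent : ℕ → List Step → ℕ
extent k []      = 0
extent k (s ∷ w) = run k s ℕ.+ extent k w

height : List Step → ℤ
height []      = 0ℤ
height (s ∷ w) = rise s ℤ.+ height w

-- A path starting at the origin is given by its word of steps.  Since every
-- step is a straight segment, it stays weakly above the axis exactly when its
-- vertices, i.e. the endpoints of its prefixes, do.

record IsPath (k n : ℕ) (w : List Step) : Set where
  field
    endsAtAbscissa : extent k w ≡ n
    endsOnAxis     : height w ≡ 0ℤ
    neverBelow     : ∀ p q → w ≡ p ++ q → 0ℤ ℤ.≤ height p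

data UH : Step → Set where
  u : UH u
  h : UH h

-- Maximality says that the segment cannot be extended on either side.  The
-- empty segment is allowed (e.g. between two consecutive down-steps); it has
-- length 0.

record IsUHSegment (w before seg after : List Step) : Set where
  field
    splits       : w ≡ before ++ seg ++ after
    composed     : All UH seg
    maximalLeft  : ∀ xs s → before ≡ xs ∷ʳ s → s ≡ d
    maximalRight : ∀ s xs → after ≡ s ∷ xs → s ≡ d

InternalSegment : List Step → List Step → Set
InternalSegment w seg =
  ∃[ before ] ∃[ after ] IsUHSegment w (before ∷ʳ d) seg (d ∷ after)

FirstSegment : List Step → List Step → Set
FirstSegment w seg = ∃[ after ] IsUHSegment w [] seg after

record IsCounted (k r ℓ : ℕ) .{{_ : NonZero k}} (w : List Step) : Set where
  field
    isPath           : IsPath k (k ℕ.* r ℕ.+ 2 ℕ.* ℓ) w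
    internalMultiple : ∀ seg → InternalSegment w seg → k ∣ extent k seg
    firstCongruent   : ∃[ seg ] FirstSegment w seg × extent k seg % k ≡ ℓ % k

-- The number of lists satisfying P is N: some duplicate-free enumeration of
-- them has length N.

HasCount : {A : Set} → (List A → Set) → ℕ → Set
HasCount {A} P N =
  Σ[ ws ∈ List (List A) ] Unique ws × (∀ w → w ∈ ws ⇔ P w) × length ws ≡ N

fromℕ : ℕ → ℚ
fromℕ n = + n ℚ./ 1

-- ∑≤ m f is the sum of f p over 0 ≤ p ≤ m.

∑≤ : ℕ → (ℕ → ℚ) → ℚ
∑≤ m f = sum {suc m} (λ i → f (toℕ i))

-- The truncated subtractions are exact for 1 ≤ k and p ≤ ⌊ r /2⌋.

term : (k r ℓ p : ℕ) → ℚ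
term k r ℓ p =
  (+ suc ℓ ℚ./ suc (k ℕ.* p ℕ.+ ℓ))
    ℚ.* fromℕ ((suc k ℕ.* p ℕ.+ ℓ) C p)
    ℚ.* fromℕ ((r ℕ.+ 2 ℕ.* (k ∸ 1) ℕ.* p ℕ.+ 2 ℕ.* ℓ) C (r ∸ 2 ℕ.* p))

{-# OPTIONS --safe #-}
module Submission where

-- After the last down-step a counted path stays on the axis, so that also its
-- last (u,h)-segment has length divisible by k.  Hence a path is counted exactly
-- when it arises as follows: the up-steps are ℓ initial ones followed by p blocks
-- u^k, where down-steps occur only between these groups, and r - 2p horizontal steps
-- are inserted at arbitrary places among the 2(kp + ℓ) other steps.  Without
-- horizontal steps these are the words in u^k and d leading from height ℓ to 0,
-- whose number is the ballot number C(n,p) - k C(n,p-1) for n = (k+1)p + ℓ: the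
-- first-step recurrence is Pascal's rule.

open import Defs
open import Data.Nat.Base using (ℕ; NonZero; _<_; ⌊_/2⌋)
open import Data.Product.Base using (∃-syntax; _×_)
open import Relation.Binary.PropositionalEquality using (_≡_)

open import Algebra.Definitions.RawMonoid using (sum)
open import Data.Empty using (⊥-elim)
open import Data.Fin.Base as Fin using (Fin; toℕ; fromℕ<)
import Data.Fin.Properties as Fin
open import Data.Integer.Base as ℤ using (+_; 0ℤ; 1ℤ)
import Data.Integer.Properties as ℤ
open import Data.List.Base using (List; []; _∷_; _++_; map)
open import Data.List.Membership.Propositional using (_∈_)
open import Data.List.Membership.Propositional.Properties
  using (∈-map⁺; ∈-map⁻; ∈-++⁺ˡ; ∈-++⁺ʳ; ∈-++⁻)
open import Data.List.Properties
  using (length-map; length-++; ∷-injective; ∷ʳ-injective; ++-assoc; ++-identityʳ)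
open import Data.List.Relation.Unary.All using (All; []; _∷_)
open import Data.List.Relation.Unary.AllPairs using ([]; _∷_)
open import Data.List.Relation.Unary.Any using (here)
import Data.List.Relation.Unary.Unique.Propositional.Properties as Unique
open import Data.Nat.Base
  using (zero; suc; _+_; _*_; _∸_; _%_; _/_; _≤_; ⌈_/2⌉; z≤n; s≤s; s≤s⁻¹; z<s; +-0-rawMonoid)
open import Data.Nat.Combinatorics using (_C_; nC1≡n; nCn≡1; k>n⇒nCk≡0; nCk+nC[k+1]≡[n+1]C[k+1])
open import Data.Nat.Divisibility using (_∣_; divides; quotient; ∣-refl; ∣m∣n⇒∣m+n; _∣0)
open import Data.Nat.DivMod using (m≡m%n+[m/n]*n; [m+kn]%n≡m%n; m<n⇒m%n≡m)
open import Data.Nat.Properties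
open import Data.Nat.Tactic.RingSolver using (solve-∀)
open import Data.Product.Base using (_,_; proj₂)
open import Data.Rational.Base as ℚ using (ℚ)
import Data.Rational.Properties as ℚ
open import Data.Rational.Unnormalised.Base as ℚᵘ using (mkℚᵘ; *≡*)
import Data.Rational.Unnormalised.Properties as ℚᵘ
open import Data.Sum.Base using (_⊎_; inj₁; inj₂)
open import Function.Base using (_∘_; case_of_)
open import Function.Bundles using (_⇔_; mk⇔; Equivalence)
open import Relation.Binary.PropositionalEquality
  using (refl; sym; trans; cong; cong₂; subst; module ≡-Reasoning)
open import Relation.Nullary.Negation using (¬_; contradiction)

open Equivalence using (to; from)

-- Binomial coefficients.

-- Both sides count the subsets of size `suc j`, with one marked element, of a set of size `j + t`.
-- The induction uses Pascal's rule; writing the size as `j + t` avoids truncated subtraction.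
C-absorb : ∀ j t → suc j * ((j + t) C suc j) ≡ t * ((j + t) C j)
C-absorb j zero = begin
  suc j * ((j + 0) C suc j) ≡⟨ cong (suc j *_) (k>n⇒nCk≡0 (s≤s (≤-reflexive (+-identityʳ j)))) ⟩
  suc j * 0                 ≡⟨ *-zeroʳ (suc j) ⟩
  0                         ∎
  where open ≡-Reasoning
C-absorb zero (suc t) = begin
  1 * (suc t C 1) ≡⟨ *-identityˡ (suc t C 1) ⟩
  suc t C 1       ≡⟨ nC1≡n (suc t) ⟩
  suc t           ≡⟨ *-identityʳ (suc t) ⟨
  suc t * 1       ∎
  where open ≡-Reasoning
C-absorb (suc j) (suc t) = begin
  suc (suc j) * (suc n C suc (suc j))
    ≡⟨ cong (suc (suc j) *_) (nCk+nC[k+1]≡[n+1]C[k+1] n (suc j)) ⟨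
  suc (suc j) * (n C suc j + n C suc (suc j))
    ≡⟨ expand j (n C suc j) (n C suc (suc j)) ⟩
  n C suc j + (suc j * (n C suc j) + suc (suc j) * (n C suc (suc j)))
    ≡⟨ cong (λ x → n C suc j + x) (cong₂ _+_ (C-absorb j (suc t))
         (subst (λ m → suc (suc j) * (m C suc (suc j)) ≡ t * (m C suc j))
           (sym (+-suc j t)) (C-absorb (suc j) t))) ⟩
  n C suc j + (suc t * (n C j) + t * (n C suc j))
    ≡⟨ collect t (n C j) (n C suc j) ⟩
  suc t * (n C j + n C suc j)
    ≡⟨ cong (suc t *_) (nCk+nC[k+1]≡[n+1]C[k+1] n j) ⟩
  suc t * (suc n C suc j) ∎
  where
  open ≡-Reasoning
  n = j + suc t
  expand : ∀ j a b → suc (suc j) * (a + b) ≡ a + (suc j * a + suc (suc j) * b)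
  expand = solve-∀
  collect : ∀ t a b → b + (suc t * a + t * b) ≡ suc t * (a + b)
  collect = solve-∀

-- Counting by disjoint unions and by the first step.

private variable
  A : Set
  P Q : List A → Set
  M N : ℕ

hasCount-cong : (∀ w → P w ⇔ Q w) → M ≡ N → HasCount P M → HasCount Q N
hasCount-cong P⇔Q refl (ws , unique , mem , len) =
  ws , unique , (λ w → mk⇔ (to (P⇔Q w) ∘ to (mem w)) (from (mem w) ∘ from (P⇔Q w))) , len

hasCount-∅ : (∀ w → ¬ P w) → HasCount P 0
hasCount-∅ ¬P = [] , [] , (λ w → mk⇔ (λ ()) (⊥-elim ∘ ¬P w)) , refl

hasCount-⊎ : (∀ w → P w → ¬ Q w) → HasCount P M → HasCount Q N →
             HasCount (λ w → P w ⊎ Q w) (M + N)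
hasCount-⊎ {P = P} {Q = Q} disjoint (ws , unique , mem , len) (ws′ , unique′ , mem′ , len′) =
  ws ++ ws′ ,
  Unique.++⁺ unique unique′ (λ { {w} (p , q) → disjoint w (to (mem w) p) (to (mem′ w) q) }) ,
  (λ w → mk⇔ (split w) (back w)) ,
  trans (length-++ ws) (cong₂ _+_ len len′)
  where
  split : ∀ w → w ∈ ws ++ ws′ → P w ⊎ Q w
  split w w∈ with ∈-++⁻ ws w∈
  ... | inj₁ x = inj₁ (to (mem w) x)
  ... | inj₂ y = inj₂ (to (mem′ w) y)
  back : ∀ w → P w ⊎ Q w → w ∈ ws ++ ws′
  back w (inj₁ x) = ∈-++⁺ˡ (from (mem w) x)
  back w (inj₂ y) = ∈-++⁺ʳ ws (from (mem′ w) y)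

hasCount-∷ : (s : A) → HasCount P N → HasCount (λ w → ∃[ v ] w ≡ s ∷ v × P v) N
hasCount-∷ s (ws , unique , mem , len) =
  map (s ∷_) ws ,
  Unique.map⁺ (proj₂ ∘ ∷-injective) unique ,
  (λ w → mk⇔
    (λ w∈ → let (v , v∈ , eq) = ∈-map⁻ (s ∷_) w∈ in v , eq , to (mem v) v∈)
    (λ { (v , refl , Pv) → ∈-map⁺ (s ∷_) (from (mem v) Pv) })) ,
  trans (length-map (s ∷_) ws) len

-- The first-step decomposition behind the counting of words. Each class is counted through its
-- tails, so that an impossible first step shows as an empty predicate.
hasCount-byHead : {P : List Step → Set} {a b c : ℕ} → ¬ P [] →
                  HasCount (P ∘ (u ∷_)) a → HasCount (P ∘ (d ∷_)) b → HasCount (P ∘ (h ∷_)) c →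
                  HasCount P (a + (b + c))
hasCount-byHead {P} ¬P[] cu cd ch =
  hasCount-cong (λ w → mk⇔ join (split w)) refl
    (hasCount-⊎ (λ { _ (_ , refl , _) (inj₁ (_ , () , _)) ; _ (_ , refl , _) (inj₂ (_ , () , _)) })
      (hasCount-∷ u cu)
      (hasCount-⊎ (λ { _ (_ , refl , _) (_ , () , _) }) (hasCount-∷ d cd) (hasCount-∷ h ch)))
  where
  Headed : Step → List Step → Set
  Headed s w = ∃[ v ] w ≡ s ∷ v × P (s ∷ v)
  join : ∀ {w} → Headed u w ⊎ (Headed d w ⊎ Headed h w) → P w
  join (inj₁ (_ , refl , p))        = p
  join (inj₂ (inj₁ (_ , refl , p))) = p
  join (inj₂ (inj₂ (_ , refl , p))) = p
  split : ∀ w → P w → Headed u w ⊎ (Headed d w ⊎ Headed h w)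
  split []      p = contradiction p ¬P[]
  split (u ∷ w) p = inj₁ (w , refl , p)
  split (d ∷ w) p = inj₂ (inj₁ (w , refl , p))
  split (h ∷ w) p = inj₂ (inj₂ (w , refl , p))

-- Disjointness is required as uniqueness of the index, the form in which `blocks-unique` supplies
-- it.
hasCount-⋃ : ∀ n {P : Fin n → List A → Set} (f : Fin n → ℕ) →
             (∀ i → HasCount (P i) (f i)) → (∀ {i j w} → P i w → P j w → i ≡ j) →
             HasCount (λ w → ∃[ i ] P i w) (sum +-0-rawMonoid f)
hasCount-⋃ zero    f count disjoint = hasCount-∅ (λ { _ (() , _) })
hasCount-⋃ (suc n) {P} f count disjoint =
  hasCount-cong (λ w → mk⇔ join split) refl
    (hasCount-⊎ (λ { w p (i , q) → contradiction (disjoint p q) λ () })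
      (count Fin.zero)
      (hasCount-⋃ n (f ∘ Fin.suc) (count ∘ Fin.suc) (λ p q → Fin.suc-injective (disjoint p q))))
  where
  join : ∀ {w} → P Fin.zero w ⊎ (∃[ i ] P (Fin.suc i) w) → ∃[ i ] P i w
  join (inj₁ p)       = Fin.zero , p
  join (inj₂ (i , p)) = Fin.suc i , p
  split : ∀ {w} → ∃[ i ] P i w → P Fin.zero w ⊎ (∃[ i ] P (Fin.suc i) w)
  split (Fin.zero  , p) = inj₁ p
  split (Fin.suc i , p) = inj₂ (i , p)

2*p≤r⇔p≤⌊r/2⌋ : ∀ p r → 2 * p ≤ r ⇔ p ≤ ⌊ r /2⌋
2*p≤r⇔p≤⌊r/2⌋ p r = mk⇔
  (λ 2*p≤r → begin
    p               ≡⟨ n≡⌊n+n/2⌋ p ⟩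
    ⌊ p + p /2⌋     ≡⟨ cong (λ q → ⌊ p + q /2⌋) (+-identityʳ p) ⟨
    ⌊ 2 * p /2⌋     ≤⟨ ⌊n/2⌋-mono 2*p≤r ⟩
    ⌊ r /2⌋         ∎)
  (λ p≤ → begin
    2 * p                   ≡⟨ cong (λ q → p + q) (+-identityʳ p) ⟩
    p + p                   ≤⟨ +-mono-≤ p≤ (≤-trans p≤ (⌊n/2⌋≤⌈n/2⌉ r)) ⟩
    ⌊ r /2⌋ + ⌈ r /2⌉       ≡⟨ ⌊n/2⌋+⌈n/2⌉≡n r ⟩
    r                       ∎)
  where open ≤-Reasoning

-- Initial and internal (u,h)-segments.

-- A computable form of the first segment: by `firstSegment-initialUH` and `firstSegment-unique` it
-- is the only one, which turns the existential in `IsCounted` into a condition on one length.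
initialUH : List Step → List Step
initialUH []      = []
initialUH (u ∷ w) = u ∷ initialUH w
initialUH (d ∷ w) = []
initialUH (h ∷ w) = h ∷ initialUH w

initialUH-UH : ∀ w → All UH (initialUH w)
initialUH-UH []      = []
initialUH-UH (u ∷ w) = u ∷ initialUH-UH w
initialUH-UH (d ∷ w) = []
initialUH-UH (h ∷ w) = h ∷ initialUH-UH w

initialUH-split : ∀ w → w ≡ initialUH w ⊎ ∃[ v ] w ≡ initialUH w ++ d ∷ v
initialUH-split []      = inj₁ refl
initialUH-split (d ∷ w) = inj₂ (w , refl)
initialUH-split (u ∷ w) with initialUH-split w
... | inj₁ eq       = inj₁ (cong (u ∷_) eq)
... | inj₂ (v , eq) = inj₂ (v , cong (u ∷_) eq)
initialUH-split (h ∷ w) with initialUH-split w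
... | inj₁ eq       = inj₁ (cong (h ∷_) eq)
... | inj₂ (v , eq) = inj₂ (v , cong (h ∷_) eq)

initialUH-unique : ∀ {seg} → All UH seg → ∀ after → (∀ s v → after ≡ s ∷ v → s ≡ d) →
                   initialUH (seg ++ after) ≡ seg
initialUH-unique []       []          max = refl
initialUH-unique []       (s ∷ after) max with refl ← max s after refl = refl
initialUH-unique (u ∷ uh) after       max = cong (u ∷_) (initialUH-unique uh after max)
initialUH-unique (h ∷ uh) after       max = cong (h ∷_) (initialUH-unique uh after max)

firstSegment-initialUH : ∀ w → FirstSegment w (initialUH w)
firstSegment-initialUH w with initialUH-split w
... | inj₁ eq = [] , record
  { splits       = trans eq (sym (++-identityʳ (initialUH w)))
  ; composed     = initialUH-UH w
  ; maximalLeft  = λ { [] _ () ; (_ ∷ _) _ () }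
  ; maximalRight = λ _ _ ()
  }
... | inj₂ (v , eq) = d ∷ v , record
  { splits       = eq
  ; composed     = initialUH-UH w
  ; maximalLeft  = λ { [] _ () ; (_ ∷ _) _ () }
  ; maximalRight = λ { _ _ refl → refl }
  }

firstSegment-unique : ∀ {w seg} → FirstSegment w seg → initialUH w ≡ seg
firstSegment-unique (after , record { splits = refl ; composed = uh ; maximalRight = max }) =
  initialUH-unique uh after max

-- Between two down-steps maximality is automatic.
internalSegment : ∀ before seg after → All UH seg →
                  InternalSegment (before ++ d ∷ seg ++ d ∷ after) seg
internalSegment before seg after uh = before , after , record
  { splits       = sym (++-assoc before (d ∷ []) (seg ++ d ∷ after))
  ; composed     = uh
  ; maximalLeft  = λ xs s eq → sym (proj₂ (∷ʳ-injective before xs eq))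
  ; maximalRight = λ { _ _ refl → refl }
  }

-- The cases are whether the down-step on the left lies in the tail or is the head. Only the latter
-- creates a new internal segment, and it was initial in the tail; hence an induction on words has
-- to keep track of the initial segment.
internalSegment-tail : ∀ {s w seg} → InternalSegment (s ∷ w) seg →
                       InternalSegment w seg ⊎ (s ≡ d × seg ≡ initialUH w)
internalSegment-tail ([] , after , record { splits = refl ; composed = uh ; maximalRight = max }) =
  inj₂ (refl , sym (initialUH-unique uh (d ∷ after) max))
internalSegment-tail {seg = seg} (_ ∷ before , after , record { splits = refl ; composed = uh }) =
  inj₁ (subst (λ w → InternalSegment w seg) (sym (++-assoc before (d ∷ []) (seg ++ d ∷ after)))
    (internalSegment before seg after uh))

internalSegment-∷ : ∀ s {w seg} → InternalSegment w seg → InternalSegment (s ∷ w) seg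
internalSegment-∷ s {seg = seg} (before , after , record { splits = refl ; composed = uh }) =
  subst (λ w → InternalSegment (s ∷ w) seg) (sym (++-assoc before (d ∷ []) (seg ++ d ∷ after)))
    (internalSegment (s ∷ before) seg after uh)

-- This separates the segments bounded by a further down-step from the last one, whose length is
-- controlled by `toAxis-UH⇒∣` instead.
internalSegment-afterFall : ∀ w → (w ≡ initialUH w) ⊎ InternalSegment (d ∷ w) (initialUH w)
internalSegment-afterFall w with initialUH-split w
... | inj₁ eq       = inj₁ eq
... | inj₂ (v , eq) = inj₂ (subst (λ w′ → InternalSegment (d ∷ w′) (initialUH w)) (sym eq)
                        (internalSegment [] (initialUH w) v (initialUH-UH w)))

-- Paths from an arbitrary height to the axis.

-- The height conditions of `IsPath` for a start at height `a`, so that they pass to suffixes. The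
-- horizontal extent is treated separately in `extent-Word`.
record ToAxis (a : ℕ) (w : List Step) : Set where
  field
    returns    : + a ℤ.+ height w ≡ 0ℤ
    staysAbove : ∀ p q → w ≡ p ++ q → 0ℤ ℤ.≤ + a ℤ.+ height p

open ToAxis

data Move : ℕ → Step → ℕ → Set where
  up    : ∀ {a} → Move a u (suc a)
  level : ∀ {a} → Move a h a
  down  : ∀ {a} → Move (suc a) d a

rise-move : ∀ {a s b} → Move a s b → + a ℤ.+ rise s ≡ + b
rise-move {a} up    = cong +_ (+-comm a 1)
rise-move {a} level = ℤ.+-identityʳ (+ a)
rise-move     down  = refl

height-move : ∀ {a s b} → Move a s b → ∀ w → + a ℤ.+ height (s ∷ w) ≡ + b ℤ.+ height w
height-move {a} {s} m w =
  trans (sym (ℤ.+-assoc (+ a) (rise s) (height w))) (cong (ℤ._+ height w) (rise-move m))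

-- Nonempty prefixes of `s ∷ w` correspond to prefixes of `w`, seen from the new height; the empty
-- prefix is harmless because `a` is natural.
toAxis-∷ : ∀ {a s b w} → Move a s b → ToAxis a (s ∷ w) ⇔ ToAxis b w
toAxis-∷ {a} {s} {b} {w} m = mk⇔
  (λ t → record
    { returns    = trans (sym (height-move m w)) (returns t)
    ; staysAbove = λ p q eq →
        subst (0ℤ ℤ.≤_) (height-move m p) (staysAbove t (s ∷ p) q (cong (s ∷_) eq))
    })
  (λ t → record
    { returns    = trans (height-move m w) (returns t)
    ; staysAbove = λ
        { []      q eq   → ℤ.+≤+ z≤n
        ; (_ ∷ p) q refl → subst (0ℤ ℤ.≤_) (sym (height-move m p)) (staysAbove t p q refl)
        }
    })

-- Without down-steps a positive height never decreases.
¬toAxis-UH : ∀ {a w} → All UH w → ¬ ToAxis (suc a) w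
¬toAxis-UH []       t = contradiction (returns t) λ ()
¬toAxis-UH (u ∷ uh) t = ¬toAxis-UH uh (to (toAxis-∷ up) t)
¬toAxis-UH (h ∷ uh) t = ¬toAxis-UH uh (to (toAxis-∷ level) t)

-- An up-step could not be undone, so only horizontal steps occur, each of length `k`.
toAxis-UH⇒∣ : ∀ k {a w} → All UH w → ToAxis a w → k ∣ extent k w
toAxis-UH⇒∣ k []       t = k ∣0
toAxis-UH⇒∣ k (u ∷ uh) t = contradiction (to (toAxis-∷ up) t) (¬toAxis-UH uh)
toAxis-UH⇒∣ k (h ∷ uh) t = ∣m∣n⇒∣m+n ∣-refl (toAxis-UH⇒∣ k uh (to (toAxis-∷ level) t))

-- Passage from natural to rational numbers.

-- Rational equations are proved for unnormalised fractions, where they amount to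
-- cross-multiplication, and carried over by `ℚ.fromℚᵘ`.
fromℚᵘ-homo-* : ∀ p q → ℚ.fromℚᵘ (p ℚᵘ.* q) ≡ ℚ.fromℚᵘ p ℚ.* ℚ.fromℚᵘ q
fromℚᵘ-homo-* p q = ℚ.toℚᵘ-injective (begin-equality
  ℚ.toℚᵘ (ℚ.fromℚᵘ (p ℚᵘ.* q))
    ≃⟨ ℚ.toℚᵘ-fromℚᵘ (p ℚᵘ.* q) ⟩
  p ℚᵘ.* q
    ≃⟨ ℚᵘ.*-cong (ℚ.toℚᵘ-fromℚᵘ p) (ℚ.toℚᵘ-fromℚᵘ q) ⟨
  ℚ.toℚᵘ (ℚ.fromℚᵘ p) ℚᵘ.* ℚ.toℚᵘ (ℚ.fromℚᵘ q)
    ≃⟨ ℚ.toℚᵘ-homo-* (ℚ.fromℚᵘ p) (ℚ.fromℚᵘ q) ⟨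
  ℚ.toℚᵘ (ℚ.fromℚᵘ p ℚ.* ℚ.fromℚᵘ q) ∎)
  where open ℚᵘ.≤-Reasoning

fromℚᵘ-homo-+ : ∀ p q → ℚ.fromℚᵘ (p ℚᵘ.+ q) ≡ ℚ.fromℚᵘ p ℚ.+ ℚ.fromℚᵘ q
fromℚᵘ-homo-+ p q = ℚ.toℚᵘ-injective (begin-equality
  ℚ.toℚᵘ (ℚ.fromℚᵘ (p ℚᵘ.+ q))
    ≃⟨ ℚ.toℚᵘ-fromℚᵘ (p ℚᵘ.+ q) ⟩
  p ℚᵘ.+ q
    ≃⟨ ℚᵘ.+-cong (ℚ.toℚᵘ-fromℚᵘ p) (ℚ.toℚᵘ-fromℚᵘ q) ⟨
  ℚ.toℚᵘ (ℚ.fromℚᵘ p) ℚᵘ.+ ℚ.toℚᵘ (ℚ.fromℚᵘ q)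
    ≃⟨ ℚ.toℚᵘ-homo-+ (ℚ.fromℚᵘ p) (ℚ.fromℚᵘ q) ⟨
  ℚ.toℚᵘ (ℚ.fromℚᵘ p ℚ.+ ℚ.fromℚᵘ q) ∎)
  where open ℚᵘ.≤-Reasoning

fromℕ-homo-+ : ∀ m n → fromℕ (m + n) ≡ fromℕ m ℚ.+ fromℕ n
fromℕ-homo-+ m n = trans
  (ℚ.fromℚᵘ-cong {mkℚᵘ (+ (m + n)) 0} {mkℚᵘ (+ m) 0 ℚᵘ.+ mkℚᵘ (+ n) 0}
    (*≡* (cong (ℤ._* 1ℤ) (sym (cong₂ ℤ._+_ (ℤ.*-identityʳ (+ m)) (ℤ.*-identityʳ (+ n)))))))
  (fromℚᵘ-homo-+ (mkℚᵘ (+ m) 0) (mkℚᵘ (+ n) 0))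

fromℕ-sum : ∀ n (f : Fin n → ℕ) (g : Fin n → ℚ) → (∀ i → fromℕ (f i) ≡ g i) →
            fromℕ (sum +-0-rawMonoid f) ≡ sum ℚ.+-0-rawMonoid g
fromℕ-sum zero    f g f≡g = refl
fromℕ-sum (suc n) f g f≡g = trans (fromℕ-homo-+ (f Fin.zero) _)
  (cong₂ ℚ._+_ (f≡g Fin.zero) (fromℕ-sum n (f ∘ Fin.suc) (g ∘ Fin.suc) (f≡g ∘ Fin.suc)))

-- Turns the division-free identity `ballot-closed` into the shape of `term`.
fromℕ-quotient : ∀ a b c e n → suc b * n ≡ a * c →
                 fromℕ (e * n) ≡ (+ a ℚ./ suc b) ℚ.* fromℕ c ℚ.* fromℕ e
fromℕ-quotient a b c e n eq = begin
  fromℕ (e * n)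
    ≡⟨ ℚ.fromℚᵘ-cong {mkℚᵘ (+ (e * n)) 0} {p ℚᵘ.* q ℚᵘ.* s} (*≡* cross) ⟩
  ℚ.fromℚᵘ (p ℚᵘ.* q ℚᵘ.* s)            ≡⟨ fromℚᵘ-homo-* (p ℚᵘ.* q) s ⟩
  ℚ.fromℚᵘ (p ℚᵘ.* q) ℚ.* fromℕ e       ≡⟨ cong (ℚ._* fromℕ e) (fromℚᵘ-homo-* p q) ⟩
  (+ a ℚ./ suc b) ℚ.* fromℕ c ℚ.* fromℕ e ∎
  where
  open ≡-Reasoning
  p = mkℚᵘ (+ a) b
  q = mkℚᵘ (+ c) 0
  s = mkℚᵘ (+ e) 0
  rearrange : ∀ e n b → e * n * (suc b * 1 * 1) ≡ e * (suc b * n)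
  rearrange = solve-∀
  rearrange′ : ∀ e a c → e * (a * c) ≡ a * c * e * 1
  rearrange′ = solve-∀
  -- `suc b * 1 * 1` is the denominator of the unnormalised product `p ℚᵘ.* q ℚᵘ.* s`.
  cross : + (e * n) ℤ.* + (suc b * 1 * 1) ≡ + a ℤ.* + c ℤ.* + e ℤ.* 1ℤ
  cross = begin
    + (e * n) ℤ.* + (suc b * 1 * 1)     ≡⟨ ℤ.pos-* (e * n) (suc b * 1 * 1) ⟨
    + (e * n * (suc b * 1 * 1))         ≡⟨ cong +_ (rearrange e n b) ⟩
    + (e * (suc b * n))                 ≡⟨ cong (λ m → + (e * m)) eq ⟩
    + (e * (a * c))                     ≡⟨ cong +_ (rearrange′ e a c) ⟩
    + (a * c * e * 1)                   ≡⟨ ℤ.pos-* (a * c * e) 1 ⟩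
    + (a * c * e) ℤ.* 1ℤ                ≡⟨ cong (ℤ._* 1ℤ) (ℤ.pos-* (a * c) e) ⟩
    + (a * c) ℤ.* + e ℤ.* 1ℤ            ≡⟨ cong (λ z → z ℤ.* + e ℤ.* 1ℤ) (ℤ.pos-* a c) ⟩
    + a ℤ.* + c ℤ.* + e ℤ.* 1ℤ          ∎

module _ (k′ : ℕ) where

  private
    k : ℕ
    k = suc k′

  -- Ballot numbers and their closed form.

  -- ballot m p counts the words in a letter of rise k and a letter of rise -1
  -- which lead from height m to height 0 without going below 0 and contain
  -- the former letter p times.
  ballot : ℕ → ℕ → ℕ
  ballot m       zero    = 1
  ballot zero    (suc p) = ballot k p
  -- The height `suc m + k` is written as one up-step made and `k′` pending, to agree definitionally
  -- with the recursion in `hasCount-Word`.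
  ballot (suc m) (suc p) = ballot (suc (suc m) + k′) p + ballot m (suc p)

  -- Here `n` is the number of letters. For positive `m`, both sides satisfy the same recurrence by
  -- Pascal's rule. The term with `k` is added rather than subtracted, and `suc p` keeps the lower
  -- index natural.
  ballot+kC≡C : ∀ m p n → n ≡ suc k * suc p + m → ballot m (suc p) + k * (n C p) ≡ n C suc p
  ballot+kC≡C zero zero n refl = begin
    1 + k * 1               ≡⟨ eq k ⟩
    suc k * 1 + 0           ≡⟨ nC1≡n (suc k * 1 + 0) ⟨
    (suc k * 1 + 0) C 1     ∎
    where
    open ≡-Reasoning
    eq : ∀ k → 1 + k * 1 ≡ suc k * 1 + 0
    eq = solve-∀
  ballot+kC≡C (suc m) zero n refl = begin
    1 + ballot m 1 + k * 1      ≡⟨ cong suc (ballot+kC≡C m zero (suc k * 1 + m) refl) ⟩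
    1 + (suc k * 1 + m) C 1     ≡⟨ cong suc (nC1≡n (suc k * 1 + m)) ⟩
    suc (suc k * 1 + m)         ≡⟨ +-suc (suc k * 1) m ⟨
    suc k * 1 + suc m           ≡⟨ nC1≡n (suc k * 1 + suc m) ⟨
    (suc k * 1 + suc m) C 1     ∎
    where open ≡-Reasoning
  ballot+kC≡C zero (suc p) n refl = begin
    ballot k (suc p) + k * (n C suc p)
      ≡⟨ cong (λ m → ballot k (suc p) + k * (m C suc p)) n≡1+n′ ⟩
    ballot k (suc p) + k * (suc n′ C suc p)
      ≡⟨ cong (λ c → ballot k (suc p) + k * c) (nCk+nC[k+1]≡[n+1]C[k+1] n′ p) ⟨
    ballot k (suc p) + k * (n′ C p + n′ C suc p)
      ≡⟨ regroup (ballot k (suc p)) k (n′ C p) (n′ C suc p) ⟩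
    (ballot k (suc p) + k * (n′ C p)) + k * (n′ C suc p)
      ≡⟨ cong₂ _+_ (ballot+kC≡C k p n′ refl) kC≡C ⟩
    n′ C suc p + n′ C suc (suc p)
      ≡⟨ nCk+nC[k+1]≡[n+1]C[k+1] n′ (suc p) ⟩
    suc n′ C suc (suc p)
      ≡⟨ cong (_C suc (suc p)) n≡1+n′ ⟨
    n C suc (suc p) ∎
    where
    open ≡-Reasoning
    n′ = suc k * suc p + k
    n≡1+n′ : n ≡ suc n′
    n≡1+n′ = eq k p
      where
      eq : ∀ k p → suc k * suc (suc p) + 0 ≡ suc (suc k * suc p + k)
      eq = solve-∀
    regroup : ∀ b k x y → b + k * (x + y) ≡ (b + k * x) + k * y
    regroup = solve-∀
    -- From height 0 no fall is possible; accordingly the closed form vanishes at height -1. This is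
    -- absorption, since `n′` exceeds `suc p` by `k * suc (suc p)`.
    kC≡C : k * (n′ C suc p) ≡ n′ C suc (suc p)
    kC≡C = *-cancelˡ-≡ _ _ (suc (suc p)) (begin
      suc (suc p) * (k * (n′ C suc p))      ≡⟨ assoc p k (n′ C suc p) ⟩
      (k * suc (suc p)) * (n′ C suc p)
        ≡⟨ subst (λ m → suc (suc p) * (m C suc (suc p)) ≡ (k * suc (suc p)) * (m C suc p))
             (eq k p) (C-absorb (suc p) (k * suc (suc p))) ⟨
      suc (suc p) * (n′ C suc (suc p))      ∎)
      where
      assoc : ∀ p k x → suc (suc p) * (k * x) ≡ (k * suc (suc p)) * x
      assoc = solve-∀
      eq : ∀ k p → suc p + k * suc (suc p) ≡ suc k * suc p + k
      eq = solve-∀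
  ballot+kC≡C (suc m) (suc p) n refl = begin
    b + b′ + k * (n C suc p)
      ≡⟨ cong (λ m → b + b′ + k * (m C suc p)) n≡1+n′ ⟩
    b + b′ + k * (suc n′ C suc p)
      ≡⟨ cong (λ c → b + b′ + k * c) (nCk+nC[k+1]≡[n+1]C[k+1] n′ p) ⟨
    b + b′ + k * (n′ C p + n′ C suc p)
      ≡⟨ regroup b b′ k (n′ C p) (n′ C suc p) ⟩
    (b + k * (n′ C p)) + (b′ + k * (n′ C suc p))
      ≡⟨ cong₂ _+_ (ballot+kC≡C (suc (suc m) + k′) p n′ (eq₂ k′ p m))
                   (ballot+kC≡C m (suc p) n′ refl) ⟩
    n′ C suc p + n′ C suc (suc p)
      ≡⟨ nCk+nC[k+1]≡[n+1]C[k+1] n′ (suc p) ⟩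
    suc n′ C suc (suc p)
      ≡⟨ cong (_C suc (suc p)) n≡1+n′ ⟨
    n C suc (suc p) ∎
    where
    open ≡-Reasoning
    n′ = suc k * suc (suc p) + m
    b = ballot (suc (suc m) + k′) (suc p)
    b′ = ballot m (suc (suc p))
    n≡1+n′ : n ≡ suc n′
    n≡1+n′ = +-suc (suc k * suc (suc p)) m
    regroup : ∀ b b′ k x y → b + b′ + k * (x + y) ≡ (b + k * x) + (b′ + k * y)
    regroup = solve-∀
    eq₂ : ∀ k′ p m → suc (suc k′) * suc (suc p) + m ≡ suc (suc k′) * suc p + (suc (suc m) + k′)
    eq₂ = solve-∀

  -- These are the Raney (Fuss-Catalan) numbers. For positive `p`, multiplying `ballot+kC≡C` by the
  -- left factor and absorbing it into the subtracted binomial leaves the factor `suc m`.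
  ballot-closed : ∀ m p → suc (k * p + m) * ballot m p ≡ suc m * ((suc k * p + m) C p)
  ballot-closed m zero    = cong (λ x → suc (x + m) * 1) (*-zeroʳ k)
  ballot-closed m (suc p) = +-cancelʳ-≡ (k * suc p * c′) _ _ (begin
    suc (k * suc p + m) * b + k * suc p * c′
      ≡⟨ cong (λ x → suc (k * suc p + m) * b + x) absorb ⟨
    suc (k * suc p + m) * b + k * (suc (k * suc p + m) * c)
      ≡⟨ factor (suc (k * suc p + m)) b k c ⟩
    suc (k * suc p + m) * (b + k * c)
      ≡⟨ cong (suc (k * suc p + m) *_) (ballot+kC≡C m p n refl) ⟩
    suc (k * suc p + m) * c′
      ≡⟨ split (k * suc p) m c′ ⟩
    suc m * c′ + k * suc p * c′ ∎)
    where
    open ≡-Reasoning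
    n = suc k * suc p + m
    b = ballot m (suc p)
    c = n C p
    c′ = n C suc p
    eq : ∀ k p m → p + suc (k * suc p + m) ≡ suc k * suc p + m
    eq = solve-∀
    factor : ∀ a b k c → a * b + k * (a * c) ≡ a * (b + k * c)
    factor = solve-∀
    split : ∀ a m c → suc (a + m) * c ≡ suc m * c + a * c
    split = solve-∀
    absorb : k * (suc (k * suc p + m) * c) ≡ k * suc p * c′
    absorb = begin
      k * (suc (k * suc p + m) * c)
        ≡⟨ cong (k *_) (subst (λ n → suc p * (n C suc p) ≡ suc (k * suc p + m) * (n C p))
             (eq k p m) (C-absorb p (suc (k * suc p + m)))) ⟨
      k * (suc p * c′)               ≡⟨ *-assoc k (suc p) c′ ⟨
      k * suc p * c′                 ∎

  -- A grammar for the counted paths.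

  -- Word a j p x w says that w leads from height a to the axis without going
  -- below it, where j up-steps complete the current (u,h)-segment to an
  -- admissible length modulo k, p further blocks of k up-steps follow, and w
  -- contains x horizontal steps.
  data Word : (a j p x : ℕ) → List Step → Set where
    done  : Word 0 0 0 0 []
    flat  : ∀ {a j p x w} → Word a j p x w → Word a j p (suc x) (h ∷ w)
    climb : ∀ {a j p x w} → Word (suc a) j p x w → Word a (suc j) p x (u ∷ w)
    block : ∀ {a p x w} → Word (suc a) k′ p x w → Word a 0 (suc p) x (u ∷ w)
    fall  : ∀ {a p x w} → Word a 0 p x w → Word (suc a) 0 p x (d ∷ w)

  -- The first step, together with whether `j` is zero, determines the constructor.
  blocks-unique : ∀ {a j p p′ x x′ w} → Word a j p x w → Word a j p′ x′ w → p ≡ p′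
  blocks-unique done      done       = refl
  blocks-unique (flat v)  (flat v′)  = blocks-unique v v′
  blocks-unique (climb v) (climb v′) = blocks-unique v v′
  blocks-unique (block v) (block v′) = cong suc (blocks-unique v v′)
  blocks-unique (fall v)  (fall v′)  = blocks-unique v v′

  -- The number of up- and down-steps of a word satisfying Word a j p x: there
  -- are j + k * p of the former, hence a + (j + k * p) of the latter.
  slopes : (a j p : ℕ) → ℕ
  slopes a j p = j + j + a + 2 * (k * p)

  private
    slopes-climb : ∀ a j p → slopes a (suc j) p ≡ suc (slopes (suc a) j p)
    slopes-climb a j p = eq a j (2 * (k * p))
      where
      eq : ∀ a j y → suc j + suc j + a + y ≡ suc (j + j + suc a + y)
      eq = solve-∀

    slopes-block : ∀ a p → slopes a 0 (suc p) ≡ suc (slopes (suc a) k′ p)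
    slopes-block a p = eq k′ a p
      where
      eq : ∀ k′ a p → 0 + 0 + a + 2 * (suc k′ * suc p) ≡ suc (k′ + k′ + suc a + 2 * (suc k′ * p))
      eq = solve-∀

  extent-Word : ∀ {a j p x w} → Word a j p x w → extent k w ≡ k * x + slopes a j p
  extent-Word done = trans (sym (*-zeroʳ (2 * k))) (eq k)
    where
    eq : ∀ k → 2 * k * 0 ≡ k * 0 + (0 + 0 + 0 + 2 * (k * 0))
    eq = solve-∀
  extent-Word {a} {j} {p} {suc x} (flat v) =
    trans (cong (λ y → k + y) (extent-Word v)) (eq k x (slopes a j p))
    where
    eq : ∀ k x y → k + (k * x + y) ≡ k * suc x + y
    eq = solve-∀
  extent-Word {a} {suc j} {p} {x} (climb v) =
    trans (cong suc (extent-Word v))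
      (trans (sym (+-suc (k * x) _)) (cong (λ y → k * x + y) (sym (slopes-climb a j p))))
  extent-Word {a} {0} {suc p} {x} (block v) =
    trans (cong suc (extent-Word v))
      (trans (sym (+-suc (k * x) _)) (cong (λ y → k * x + y) (sym (slopes-block a p))))
  extent-Word {x = x} (fall v) =
    trans (cong suc (extent-Word v)) (sym (+-suc (k * x) _))

  -- Counting the words of the grammar.

  private
    -- b is the number of arrangements of the s sloped steps, and x horizontal
    -- steps are inserted arbitrarily between them.
    wordCount : ℕ → ℕ → ℕ → ℕ
    wordCount s x b = ((s + x) C x) * b

    -- The share of `wordCount s x b` whose words begin with a horizontal step.
    flatCount : ℕ → ℕ → ℕ → ℕ
    flatCount s zero    b = 0
    flatCount s (suc x) b = wordCount s x b

    -- With `b` and `b′` the numbers of arrangements beginning with `u` and `d`, this sorts the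
    -- words by first step; it is Pascal's rule for the insertions.
    wordCount-suc : ∀ s x b b′ →
                    wordCount s x b + (wordCount s x b′ + flatCount (suc s) x (b + b′)) ≡
                    wordCount (suc s) x (b + b′)
    wordCount-suc s zero    b b′ = eq b b′
      where
      eq : ∀ b b′ → 1 * b + (1 * b′ + 0) ≡ 1 * (b + b′)
      eq = solve-∀
    wordCount-suc s (suc x) b b′ = begin
      ((s + suc x) C suc x) * b + (((s + suc x) C suc x) * b′ + ((suc s + x) C x) * (b + b′))
        ≡⟨ cong (λ m → ((s + suc x) C suc x) * b +
                       (((s + suc x) C suc x) * b′ + (m C x) * (b + b′))) (+-suc s x) ⟨
      ((s + suc x) C suc x) * b + (((s + suc x) C suc x) * b′ + ((s + suc x) C x) * (b + b′))
        ≡⟨ eq ((s + suc x) C x) ((s + suc x) C suc x) b b′ ⟩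
      ((s + suc x) C x + (s + suc x) C suc x) * (b + b′)
        ≡⟨ cong (_* (b + b′)) (nCk+nC[k+1]≡[n+1]C[k+1] (s + suc x) x) ⟩
      (suc (s + suc x) C suc x) * (b + b′) ∎
      where
      open ≡-Reasoning
      eq : ∀ y z b b′ → z * b + (z * b′ + y * (b + b′)) ≡ (y + z) * (b + b′)
      eq = solve-∀

    -- Gives an impossible sloped first step the form of a summand in `wordCount-suc`.
    hasCount-0 : ∀ {P : List Step → Set} s x → (∀ w → ¬ P w) → HasCount P (wordCount s x 0)
    hasCount-0 s x ¬P = subst (HasCount _) (sym (*-zeroʳ ((s + x) C x))) (hasCount-∅ ¬P)

    wordCount-flat : ∀ x → wordCount (slopes 0 0 0) x 1 ≡ 1
    wordCount-flat x =
      trans (*-identityʳ _) (trans (cong (λ y → (2 * y + x) C x) (*-zeroʳ k)) (nCn≡1 x))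

  mutual
    -- The order of the arguments makes the recursion lexicographic: a block lowers `p`, a climb
    -- `j`, a fall `a` and a horizontal step `x`.
    hasCount-Word : ∀ p j a x → HasCount (Word a j p x) (wordCount (slopes a j p) x (ballot (a + j) p))
    hasCount-Word zero zero zero zero =
      ([] ∷ []) , ([] ∷ []) , (λ w → mk⇔ (λ { (here refl) → done }) (λ { done → here refl })) ,
      sym (wordCount-flat 0)
    hasCount-Word zero zero zero (suc x) =
      subst (HasCount _) (trans (wordCount-flat x) (sym (wordCount-flat (suc x))))
        (hasCount-byHead (λ ()) (hasCount-∅ (λ _ ())) (hasCount-∅ (λ _ ()))
          (hasCount-flat zero zero zero (suc x)))
    -- As regards ballot, the pending up-steps count as already made.
    hasCount-Word p (suc j) a x =
      subst (HasCount _)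
        (trans (wordCount-suc (slopes (suc a) j p) x _ 0)
          (cong₂ (λ s b → wordCount s x b) (sym (slopes-climb a j p)) eq))
        (hasCount-byHead (λ ())
          (hasCount-cong (λ w → mk⇔ climb (λ { (climb v) → v })) refl (hasCount-Word p j (suc a) x))
          (hasCount-0 (slopes (suc a) j p) x (λ _ ()))
          (subst (HasCount _)
            (cong₂ (λ s b → flatCount s x b) (slopes-climb a j p) (sym eq))
            (hasCount-flat p (suc j) a x)))
      where
      eq : ballot (suc a + j) p + 0 ≡ ballot (a + suc j) p
      eq = trans (+-identityʳ _) (cong (λ m → ballot m p) (sym (+-suc a j)))
    hasCount-Word zero zero (suc a) x =
      subst (HasCount _) (wordCount-suc (slopes a 0 0) x 0 1)
        (hasCount-byHead (λ ())
          (hasCount-0 (slopes a 0 0) x (λ _ ()))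
          (hasCount-cong (λ w → mk⇔ fall (λ { (fall v) → v })) refl (hasCount-Word zero zero a x))
          (hasCount-flat zero zero (suc a) x))
    hasCount-Word (suc p) zero zero x =
      subst (HasCount _)
        (trans (wordCount-suc (slopes 1 k′ p) x (ballot k p) 0)
          (cong₂ (λ s b → wordCount s x b) (sym (slopes-block 0 p)) (+-identityʳ (ballot k p))))
        (hasCount-byHead (λ ())
          (hasCount-cong (λ w → mk⇔ block (λ { (block v) → v })) refl (hasCount-Word p k′ 1 x))
          (hasCount-0 (slopes 1 k′ p) x (λ _ ()))
          (subst (HasCount _)
            (cong₂ (λ s b → flatCount s x b) (slopes-block 0 p) (sym (+-identityʳ (ballot k p))))
            (hasCount-flat (suc p) zero zero x)))
    hasCount-Word (suc p) zero (suc a) x =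
      subst (HasCount _)
        (trans (wordCount-suc s x b (ballot a (suc p)))
          (cong₂ (λ s b → wordCount s x b) s≡ b≡))
        (hasCount-byHead (λ ())
          (hasCount-cong (λ w → mk⇔ block (λ { (block v) → v })) refl
            (hasCount-Word p k′ (suc (suc a)) x))
          -- `wordCount-suc` needs the same number `s` of remaining sloped steps after a fall as
          -- after the start of a block.
          (hasCount-cong (λ w → mk⇔ fall (λ { (fall v) → v }))
            (cong₂ (λ s m → wordCount s x (ballot m (suc p)))
              (suc-injective (slopes-block (suc a) p)) (+-identityʳ a))
            (hasCount-Word (suc p) zero a x))
          (subst (HasCount _)
            (cong₂ (λ s b → flatCount s x b) (sym s≡) (sym b≡))
            (hasCount-flat (suc p) zero (suc a) x)))
      where
      s = slopes (suc (suc a)) k′ p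
      b = ballot (suc (suc a) + k′) p
      s≡ = sym (slopes-block (suc a) p)
      b≡ : b + ballot a (suc p) ≡ ballot (suc a + 0) (suc p)
      b≡ = cong (λ m → ballot (suc m) (suc p)) (sym (+-identityʳ a))

    hasCount-flat : ∀ p j a x → HasCount (Word a j p x ∘ (h ∷_))
                                         (flatCount (slopes a j p) x (ballot (a + j) p))
    hasCount-flat p j a zero    = hasCount-∅ (λ _ ())
    hasCount-flat p j a (suc x) =
      hasCount-cong (λ w → mk⇔ flat (λ { (flat v) → v })) refl (hasCount-Word p j a x)

  -- The grammar describes exactly the counted paths.

  -- The counting conditions, relaxed to be inherited by suffixes. For `j < k` the field `initial`
  -- says that the initial length is congruent to `j` modulo `k`.
  record Admissible (a j : ℕ) (w : List Step) : Set where
    field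
      toAxis   : ToAxis a w
      internal : ∀ seg → InternalSegment w seg → k ∣ extent k seg
      initial  : ∃[ c ] extent k (initialUH w) ≡ j + c * k

  open Admissible

  Word⇒Admissible : ∀ {a j p x w} → Word a j p x w → Admissible a j w
  Word⇒Admissible done = record
    { toAxis   = record { returns = refl ; staysAbove = λ { [] _ _ → ℤ.+≤+ z≤n ; (_ ∷ _) _ () } }
    ; internal = λ { _ ([] , _ , record { splits = () }) ; _ (_ ∷ _ , _ , record { splits = () }) }
    ; initial  = 0 , refl
    }
  Word⇒Admissible {j = j} (flat v) with Word⇒Admissible v
  ... | adm = record
    { toAxis   = from (toAxis-∷ level) (toAxis adm)
    ; internal = λ seg is → case internalSegment-tail is of λ
        { (inj₁ is′) → internal adm seg is′ ; (inj₂ (() , _)) }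
    ; initial  = let (c , eq) = initial adm in
        suc c , trans (cong (λ y → k + y) eq) (swap k j (c * k))
    }
    where
    swap : ∀ k j y → k + (j + y) ≡ j + (k + y)
    swap = solve-∀
  Word⇒Admissible (climb v) with Word⇒Admissible v
  ... | adm = record
    { toAxis   = from (toAxis-∷ up) (toAxis adm)
    ; internal = λ seg is → case internalSegment-tail is of λ
        { (inj₁ is′) → internal adm seg is′ ; (inj₂ (() , _)) }
    ; initial  = let (c , eq) = initial adm in c , cong suc eq
    }
  Word⇒Admissible (block v) with Word⇒Admissible v
  ... | adm = record
    { toAxis   = from (toAxis-∷ up) (toAxis adm)
    ; internal = λ seg is → case internalSegment-tail is of λ
        { (inj₁ is′) → internal adm seg is′ ; (inj₂ (() , _)) }
    ; initial  = let (c , eq) = initial adm in suc c , cong suc eq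
    }
  Word⇒Admissible (fall v) with Word⇒Admissible v
  ... | adm = record
    { toAxis   = from (toAxis-∷ down) (toAxis adm)
    ; internal = λ seg is → case internalSegment-tail is of λ
        { (inj₁ is′) → internal adm seg is′
        -- The tail after a fall has no pending up-steps, so its initial length is `c * k`.
        ; (inj₂ (_ , refl)) → let (c , eq) = initial adm in divides c eq }
    ; initial  = 0 , refl
    }

  -- The first step and `j` select the constructor; `initial` and `toAxis` exclude the remaining
  -- cases.
  Admissible⇒Word : ∀ w {a j} → j < k → Admissible a j w → ∃[ p ] ∃[ x ] Word a j p x w
  Admissible⇒Word [] {zero}  {zero}  _ adm = 0 , 0 , done
  Admissible⇒Word [] {zero}  {suc j} _ adm = contradiction (proj₂ (initial adm)) λ ()
  Admissible⇒Word [] {suc a}         _ adm = contradiction (returns (toAxis adm)) λ ()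
  Admissible⇒Word (h ∷ w) {a} {j} j<k adm =
    let (p , x , v) = Admissible⇒Word w j<k record
          { toAxis   = to (toAxis-∷ level) (toAxis adm)
          ; internal = λ seg is → internal adm seg (internalSegment-∷ h is)
          ; initial  = drop (initial adm)
          }
    in p , suc x , flat v
    where
    drop : ∃[ c ] k + extent k (initialUH w) ≡ j + c * k → ∃[ c ] extent k (initialUH w) ≡ j + c * k
    -- Here the horizontal step alone would force `k ≤ j`.
    drop (zero  , eq) =
      contradiction (≤-trans (m≤m+n k _) (≤-reflexive (trans eq (+-identityʳ j)))) (<⇒≱ j<k)
    drop (suc c , eq) = c , +-cancelˡ-≡ k _ _ (trans eq (swap k j (c * k)))
      where
      swap : ∀ k j y → j + (k + y) ≡ k + (j + y)
      swap = solve-∀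
  Admissible⇒Word (u ∷ w) {a} {suc j} j<k adm =
    let (p , x , v) = Admissible⇒Word w (<-trans (n<1+n j) j<k) record
          { toAxis   = to (toAxis-∷ up) (toAxis adm)
          ; internal = λ seg is → internal adm seg (internalSegment-∷ u is)
          ; initial  = let (c , eq) = initial adm in c , suc-injective eq
          }
    in p , x , climb v
  Admissible⇒Word (u ∷ w) {a} {zero} j<k adm =
    let (p , x , v) = Admissible⇒Word w (n<1+n k′) record
          { toAxis   = to (toAxis-∷ up) (toAxis adm)
          ; internal = λ seg is → internal adm seg (internalSegment-∷ u is)
          ; initial  = drop (initial adm)
          }
    in suc p , x , block v
    where
    drop : ∃[ c ] suc (extent k (initialUH w)) ≡ c * k → ∃[ c ] extent k (initialUH w) ≡ k′ + c * k
    drop (suc c , eq) = c , suc-injective eq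
  Admissible⇒Word (d ∷ w) {zero} j<k adm = contradiction (staysAbove (toAxis adm) (d ∷ []) w refl) λ ()
  Admissible⇒Word (d ∷ w) {suc a} {suc j} j<k adm = contradiction (proj₂ (initial adm)) λ ()
  Admissible⇒Word (d ∷ w) {suc a} {zero} j<k adm =
    let (p , x , v) = Admissible⇒Word w z<s record
          { toAxis   = toAxis′
          ; internal = λ seg is → internal adm seg (internalSegment-∷ d is)
          ; initial  = quotient k∣initial , _∣_.equality k∣initial
          }
    in p , x , fall v
    where
    toAxis′ : ToAxis a w
    toAxis′ = to (toAxis-∷ down) (toAxis adm)
    k∣initial : k ∣ extent k (initialUH w)
    k∣initial with internalSegment-afterFall w
    -- The last segment: no down-step follows, so returning to the axis forces its length to be a
    -- multiple of `k`.
    ... | inj₁ eq = subst (λ v → k ∣ extent k v) eq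
        (toAxis-UH⇒∣ k (subst (All UH) (sym eq) (initialUH-UH w)) toAxis′)
    ... | inj₂ is = internal adm (initialUH w) is

  IsCounted⇔Word : ∀ {r ℓ w} → ℓ < k →
                   IsCounted k r ℓ w ⇔ (∃[ p ] p ≤ ⌊ r /2⌋ × Word 0 ℓ p (r ∸ 2 * p) w)
  IsCounted⇔Word {r} {ℓ} {w} ℓ<k = mk⇔ forth back
    where
    open ≡-Reasoning
    slopes-initial : ∀ p x → k * x + slopes 0 ℓ p ≡ k * (x + 2 * p) + 2 * ℓ
    slopes-initial p x = eq k ℓ p x
      where
      eq : ∀ k ℓ p x → k * x + (ℓ + ℓ + 0 + 2 * (k * p)) ≡ k * (x + 2 * p) + 2 * ℓ
      eq = solve-∀
    forth : IsCounted k r ℓ w → ∃[ p ] p ≤ ⌊ r /2⌋ × Word 0 ℓ p (r ∸ 2 * p) w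
    forth ic =
      let (p , x , v) = Admissible⇒Word w ℓ<k record
            { toAxis   = record
                { returns    = trans (ℤ.+-identityˡ _) endsOnAxis
                ; staysAbove = λ p q eq → subst (0ℤ ℤ.≤_) (sym (ℤ.+-identityˡ _)) (neverBelow p q eq)
                }
            ; internal = internalMultiple
            ; initial  = initial′ firstCongruent
            }
          -- The prescribed abscissa determines the number of horizontal steps and thereby bounds
          -- `p`.
          r≡ : r ≡ x + 2 * p
          r≡ = *-cancelˡ-≡ _ _ k (+-cancelʳ-≡ (2 * ℓ) _ _ (begin
            k * r + 2 * ℓ              ≡⟨ endsAtAbscissa ⟨
            extent k w                 ≡⟨ extent-Word v ⟩
            k * x + slopes 0 ℓ p       ≡⟨ slopes-initial p x ⟩
            k * (x + 2 * p) + 2 * ℓ    ∎))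
      in p ,
         to (2*p≤r⇔p≤⌊r/2⌋ p r) (≤-trans (m≤n+m (2 * p) x) (≤-reflexive (sym r≡))) ,
         subst (λ y → Word 0 ℓ p y w) (sym (trans (cong (_∸ 2 * p) r≡) (m+n∸n≡m x (2 * p)))) v
      where
      open IsCounted ic
      open IsPath isPath
      initial′ : ∃[ seg ] FirstSegment w seg × extent k seg % k ≡ ℓ % k →
                 ∃[ c ] extent k (initialUH w) ≡ ℓ + c * k
      initial′ (seg , first , eq) = extent k seg / k , (begin
        extent k (initialUH w)                     ≡⟨ cong (extent k) (firstSegment-unique first) ⟩
        extent k seg                               ≡⟨ m≡m%n+[m/n]*n (extent k seg) k ⟩
        extent k seg % k + extent k seg / k * k
          ≡⟨ cong (_+ extent k seg / k * k) (trans eq (m<n⇒m%n≡m ℓ<k)) ⟩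
        ℓ + extent k seg / k * k                   ∎)
    back : ∃[ p ] p ≤ ⌊ r /2⌋ × Word 0 ℓ p (r ∸ 2 * p) w → IsCounted k r ℓ w
    back (p , p≤ , v) = record
      { isPath = record
        { endsAtAbscissa = begin
            extent k w                             ≡⟨ extent-Word v ⟩
            k * (r ∸ 2 * p) + slopes 0 ℓ p         ≡⟨ slopes-initial p (r ∸ 2 * p) ⟩
            k * (r ∸ 2 * p + 2 * p) + 2 * ℓ
              ≡⟨ cong (λ y → k * y + 2 * ℓ) (m∸n+n≡m (from (2*p≤r⇔p≤⌊r/2⌋ p r) p≤)) ⟩
            k * r + 2 * ℓ                          ∎
        ; endsOnAxis     = trans (sym (ℤ.+-identityˡ _)) (returns (toAxis adm))
        ; neverBelow     = λ p q eq → subst (0ℤ ℤ.≤_) (ℤ.+-identityˡ _) (staysAbove (toAxis adm) p q eq)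
        }
      ; internalMultiple = internal adm
      ; firstCongruent   = initialUH w , firstSegment-initialUH w ,
          (let (c , eq) = initial adm in trans (cong (_% k) eq) ([m+kn]%n≡m%n ℓ c k))
      }
      where adm = Word⇒Admissible v

-- Summation over the number of blocks.

-- Brings the total number of steps into the form of the upper index in `term`.
slopes-count : ∀ k′ r ℓ p → 2 * p ≤ r →
               slopes k′ 0 ℓ p + (r ∸ 2 * p) ≡ r + 2 * k′ * p + 2 * ℓ
slopes-count k′ r ℓ p 2p≤r = begin
  slopes k′ 0 ℓ p + x                   ≡⟨ eq k′ ℓ p x ⟩
  x + 2 * p + 2 * k′ * p + 2 * ℓ        ≡⟨ cong (λ y → y + 2 * k′ * p + 2 * ℓ) (m∸n+n≡m 2p≤r) ⟩
  r + 2 * k′ * p + 2 * ℓ                ∎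
  where
  open ≡-Reasoning
  x = r ∸ 2 * p
  eq : ∀ k′ ℓ p x → ℓ + ℓ + 0 + 2 * (suc k′ * p) + x ≡ x + 2 * p + 2 * k′ * p + 2 * ℓ
  eq = solve-∀

theorem5p1 : (k r ℓ : ℕ) .{{_ : NonZero k}} → ℓ < k →
    ∃[ N ] HasCount (IsCounted k r ℓ) N × fromℕ N ≡ ∑≤ ⌊ r /2⌋ (term k r ℓ)
theorem5p1 k@(suc k′) r ℓ ℓ<k = sum +-0-rawMonoid count ,
  hasCount-cong
    (λ w → mk⇔
      (λ { (i , v) → from (IsCounted⇔Word k′ ℓ<k) (toℕ i , i≤ i , v) })
      (λ ic → let (p , p≤ , v) = to (IsCounted⇔Word k′ ℓ<k) ic in
        fromℕ< (s≤s p≤) ,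
        subst (λ p → Word k′ 0 ℓ p (r ∸ 2 * p) w) (sym (Fin.toℕ-fromℕ< (s≤s p≤))) v))
    refl
    (hasCount-⋃ (suc ⌊ r /2⌋) count
      (λ i → subst (HasCount _) (count≡ i)
        (hasCount-Word k′ (toℕ i) ℓ 0 (r ∸ 2 * toℕ i)))
      -- A word determines its number of blocks, so the classes for different `p` are disjoint.
      (λ v v′ → Fin.toℕ-injective (blocks-unique k′ v v′))) ,
  fromℕ-sum (suc ⌊ r /2⌋) count (term k r ℓ ∘ toℕ)
    (λ i → fromℕ-quotient (suc ℓ) (k * toℕ i + ℓ)
      ((suc k * toℕ i + ℓ) C toℕ i) ((r + 2 * k′ * toℕ i + 2 * ℓ) C (r ∸ 2 * toℕ i))
      (ballot k′ ℓ (toℕ i))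
      (ballot-closed k′ ℓ (toℕ i)))
  where
  count : Fin (suc ⌊ r /2⌋) → ℕ
  count i = ((r + 2 * k′ * toℕ i + 2 * ℓ) C (r ∸ 2 * toℕ i)) * ballot k′ ℓ (toℕ i)
  i≤ : ∀ (i : Fin (suc ⌊ r /2⌋)) → toℕ i ≤ ⌊ r /2⌋
  i≤ i = s≤s⁻¹ (Fin.toℕ<n i)
  count≡ : ∀ i → ((slopes k′ 0 ℓ (toℕ i) + (r ∸ 2 * toℕ i)) C (r ∸ 2 * toℕ i)) *
                 ballot k′ ℓ (toℕ i) ≡ count i
  count≡ i = cong (λ n → (n C (r ∸ 2 * toℕ i)) * ballot k′ ℓ (toℕ i))
    (slopes-count k′ r ℓ (toℕ i) (from (2*p≤r⇔p≤⌊r/2⌋ (toℕ i) r) (i≤ i)))
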